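{- For all integers $d \ge 2$ and $n \ge d^2$, \[f(n,d) = f(n-d+1,d) + f(n-d,d) - f(n-2d+1,d) + f(n-2d+1,d-1).\]
   Context: A partition of a positive integer $n$ is a finite sequence of positive integers $\lambda = (\lambda_1,\ldots,\lambda_j)$ with $\lambda_1 \ge \cdots \ge \lambda_j$ and $\sum_i \lambda_i = n$; the $\lambda_i$ are its parts. For integers $n \ge 1$ and $d \ge 1$, a partition $\lambda$ of $n$ has fixed point $d$ if $\lambda$ has at least $d$ parts and $\lambda_d = d$ (a partition has at most one fixed point). Let $f(n,d)$ denote the number of partitions of $n$ with fixed point $d$. -}

module Defs where

open import Data.Nat using (ℕ; zero; suc; _≥_; NonZero)
open import Data.Nat.ListAction using (sum)
open import Data.Nat.Properties using (_≟_; _≥?_; suc-injective)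
open import Data.Fin using (toℕ)
open import Data.Fin.Properties using (any?)
open import Data.List using (List; []; _∷_; _++_; map; filter; length; lookup)
open import Data.List.Properties using (∷-injectiveˡ; ∷-injectiveʳ)
open import Data.List.Membership.Propositional using (_∈_)
open import Data.List.Membership.Propositional.Properties
  using (∈-map⁺; ∈-map⁻; ∈-++⁺ˡ; ∈-++⁺ʳ; ∈-++⁻; ∈-filter⁺; ∈-filter⁻)
open import Data.List.Relation.Unary.All using (All; []; _∷_)
open import Data.List.Relation.Unary.Any using (here)
open import Data.List.Relation.Unary.Linked using (Linked; linked?)
open import Data.List.Relation.Unary.Unique.Propositional using (Unique; []; _∷_)
import Data.List.Relation.Unary.Unique.Propositional.Properties as Unique
open import Data.Product using (_×_; _,_; ∃-syntax)
open import Data.Sum using (inj₁; inj₂)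
open import Function using (_⇔_; mk⇔)
open import Relation.Binary.PropositionalEquality using (_≡_; refl; cong; cong₂)
open import Relation.Nullary using (Dec)
open import Relation.Nullary.Decidable using (_×-dec_)

record IsPartition (n : ℕ) (xs : List ℕ) : Set where
  constructor isPartition
  field
    positive      : All NonZero xs
    nonincreasing : Linked _≥_ xs
    sum≡n         : sum xs ≡ n

-- Parts are numbered from 1, whereas positions in Fin start at 0.
HasFixedPoint : ℕ → List ℕ → Set
HasFixedPoint d xs = ∃[ i ] suc (toℕ {length xs} i) ≡ d × lookup xs i ≡ d

hasFixedPoint? : ∀ d xs → Dec (HasFixedPoint d xs)
hasFixedPoint? d xs = any? λ i → (suc (toℕ i) ≟ d) ×-dec (lookup xs i ≟ d)

incrementHead : List ℕ → List ℕ
incrementHead []       = []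
incrementHead (x ∷ xs) = suc x ∷ xs

-- Every finite sequence of positive integers with sum n.
compositions : ℕ → List (List ℕ)
compositions zero          = [] ∷ []
compositions (suc zero)    = (1 ∷ []) ∷ []
compositions (suc (suc n)) =
  map (1 ∷_) (compositions (suc n)) ++ map incrementHead (compositions (suc n))

partitions : ℕ → List (List ℕ)
partitions n = filter (linked? _≥?_) (compositions n)

-- The number of partitions of n with fixed point d; that each such partition
-- is listed exactly once is shown by ∈-fixedPointPartitions and
-- fixedPointPartitions-unique below.
fixedPointPartitions : ℕ → ℕ → List (List ℕ)
fixedPointPartitions n d = filter (hasFixedPoint? d) (partitions n)

f : ℕ → ℕ → ℕ
f n d = length (fixedPointPartitions n d)

compositions-sound : ∀ n {xs} → xs ∈ compositions n → All NonZero xs × sum xs ≡ n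
compositions-sound zero          (here refl) = [] , refl
compositions-sound (suc zero)    (here refl) = _ ∷ [] , refl
compositions-sound (suc (suc n)) = step (compositions-sound (suc n))
  where
  step : (∀ {ys} → ys ∈ compositions (suc n) → All NonZero ys × sum ys ≡ suc n) →
         ∀ {xs} → xs ∈ compositions (suc (suc n)) → All NonZero xs × sum xs ≡ suc (suc n)
  step ih p with ∈-++⁻ (map (1 ∷_) (compositions (suc n))) p
  step ih p | inj₁ q with ∈-map⁻ (1 ∷_) q
  ... | ys , ys∈ , refl with ih ys∈
  ...   | pos , eq = _ ∷ pos , cong suc eq
  step ih p | inj₂ q with ∈-map⁻ incrementHead q
  ... | [] , ys∈ , refl with ih ys∈
  ...   | _ , ()
  step ih p | inj₂ q | y ∷ ys , ys∈ , refl with ih ys∈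
  ...   | _ ∷ pos , eq = _ ∷ pos , cong suc eq

compositions-complete : ∀ n {xs} → All NonZero xs → sum xs ≡ n → xs ∈ compositions n
compositions-complete zero       []                     refl = here refl
compositions-complete zero       (_∷_ {suc _} _ _)      ()
compositions-complete (suc _)    []                     ()
compositions-complete (suc zero) (_∷_ {suc zero} _ [])  refl = here refl
compositions-complete (suc zero) (_∷_ {suc zero} _ (_∷_ {suc _} _ _)) ()
compositions-complete (suc zero) (_∷_ {suc (suc _)} _ _) ()
compositions-complete (suc (suc n)) (_∷_ {suc zero} _ pos) eq =
  ∈-++⁺ˡ (∈-map⁺ (1 ∷_) (compositions-complete (suc n) pos (suc-injective eq)))
compositions-complete (suc (suc n)) (_∷_ {suc (suc x)} _ pos) eq =
  ∈-++⁺ʳ (map (1 ∷_) (compositions (suc n)))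
    (∈-map⁺ incrementHead (compositions-complete (suc n) (_∷_ {x = suc x} _ pos) (suc-injective eq)))

incrementHead-injective : ∀ {xs ys} → incrementHead xs ≡ incrementHead ys → xs ≡ ys
incrementHead-injective {[]}    {[]}    _  = refl
incrementHead-injective {_ ∷ _} {_ ∷ _} eq =
  cong₂ _∷_ (suc-injective (∷-injectiveˡ eq)) (∷-injectiveʳ eq)

compositions-unique : ∀ n → Unique (compositions n)
compositions-unique zero          = [] ∷ []
compositions-unique (suc zero)    = [] ∷ []
compositions-unique (suc (suc n)) =
  Unique.++⁺ (Unique.map⁺ ∷-injectiveʳ (compositions-unique (suc n)))
             (Unique.map⁺ incrementHead-injective (compositions-unique (suc n)))
             disjoint
  where
  disjoint : ∀ {xs} → xs ∈ map (1 ∷_) (compositions (suc n))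
           × xs ∈ map incrementHead (compositions (suc n)) → _
  disjoint (p , q) with ∈-map⁻ (1 ∷_) p | ∈-map⁻ incrementHead q
  ... | _ , _ , refl | zero ∷ _ , ys∈ , refl with compositions-sound (suc n) ys∈
  ...   | record { nonZero = () } ∷ _ , _

∈-partitions : ∀ n {xs} → xs ∈ partitions n ⇔ IsPartition n xs
∈-partitions n = mk⇔ to from
  where
  to : ∀ {xs} → xs ∈ partitions n → IsPartition n xs
  to p with ∈-filter⁻ (linked? _≥?_) p
  ... | q , noninc with compositions-sound n q
  ...   | pos , eq = isPartition pos noninc eq

  from : ∀ {xs} → IsPartition n xs → xs ∈ partitions n
  from (isPartition pos noninc eq) =
    ∈-filter⁺ (linked? _≥?_) (compositions-complete n pos eq) noninc

∈-fixedPointPartitions : ∀ n d {xs} →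
  xs ∈ fixedPointPartitions n d ⇔ (IsPartition n xs × HasFixedPoint d xs)
∈-fixedPointPartitions n d = mk⇔ to from
  where
  open Function.Equivalence using () renaming (to to fwd; from to bwd)

  to : ∀ {xs} → xs ∈ fixedPointPartitions n d → IsPartition n xs × HasFixedPoint d xs
  to p with ∈-filter⁻ (hasFixedPoint? d) p
  ... | q , fp = fwd (∈-partitions n) q , fp

  from : ∀ {xs} → IsPartition n xs × HasFixedPoint d xs → xs ∈ fixedPointPartitions n d
  from (q , fp) = ∈-filter⁺ (hasFixedPoint? d) (bwd (∈-partitions n) q) fp

fixedPointPartitions-unique : ∀ n d → Unique (fixedPointPartitions n d)
fixedPointPartitions-unique n d =
  Unique.filter⁺ (hasFixedPoint? d)
    (Unique.filter⁺ (linked? _≥?_) (compositions-unique n))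

{-# OPTIONS --safe #-}

-- With k = d − 1, adding 1 to each of the first k parts embeds the partitions of m with fixed
-- point d into those of m + k, and misses exactly the "flat" ones, those with λ_k = λ_d = d.
-- A flat partition of m + d arises by duplicating the part λ_k = d in a partition μ of m with
-- μ_k = d. Either μ_d = d, so that μ is itself flat, or μ_d < d (or μ has only k parts), and then
-- subtracting 1 from each of the first k parts of μ gives a partition of m − k with fixed point k.
-- Eliminating the flat counts from these two identities gives the recurrence.
module Submission where

open import Defs
open import Data.Nat using (ℕ; _≥_; _∸_; _^_; _*_) renaming (_+_ to _+ℕ_)
open import Data.Integer using (+_; _+_; _-_)
open import Relation.Binary.PropositionalEquality using (_≡_)
open import Data.Fin using (Fin; zero; suc; toℕ)
import Data.Integer.Tactic.RingSolver as ℤ-Solver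
open import Data.List using (List; []; _∷_; _++_; map; filter; length; lookup; head; drop)
open import Data.List.Membership.Propositional using (_∈_)
open import Data.List.Membership.Propositional.Properties
  using (∈-map⁺; ∈-map⁻; ∈-++⁺ˡ; ∈-++⁺ʳ; ∈-++⁻; ∈-filter⁺; ∈-filter⁻)
open import Data.List.Membership.Propositional.Properties.WithK using (unique∧set⇒bag)
open import Data.List.Properties using (length-map; length-++; ∷-injectiveˡ; ∷-injectiveʳ)
open import Data.List.Relation.Binary.BagAndSetEquality using (∼bag⇒↭)
open import Data.List.Relation.Binary.Permutation.Propositional.Properties using (↭-length)
open import Data.List.Relation.Unary.All using (All; []; _∷_)
open import Data.List.Relation.Unary.Linked using (Linked; []; [-]; _∷_)
open import Data.List.Relation.Unary.Unique.Propositional using (Unique)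
import Data.List.Relation.Unary.Unique.Propositional.Properties as Unique
open import Data.Maybe as Maybe using (Maybe; just)
open import Data.Maybe.Properties using (just-injective; ≡-dec)
open import Data.Nat using (zero; suc; _≤_; s≤s; s≤s⁻¹; NonZero)
open import Data.Nat.ListAction using (sum)
open import Data.Nat.Properties
  using (_≟_; ≤-refl; ≤-reflexive; ≤-trans; ≤∧≢⇒<; <-irrefl; suc-injective; m≤m+n; m≤n⇒m≤1+n;
         m∸n+n≡m; m+n∸n≡m; +-suc; +-assoc; +-comm; +-cancelʳ-≡; *-identityʳ; *-mono-≤)
import Data.Nat.Tactic.RingSolver as ℕ-Solver
open import Data.Product using (_×_; _,_; ∃-syntax; proj₁)
open import Data.Sum using (_⊎_; inj₁; inj₂)
open import Function using (_⇔_; mk⇔; _∘_; id)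
open import Relation.Binary.PropositionalEquality
  using (refl; sym; trans; cong; cong₂; subst; module ≡-Reasoning)
open import Relation.Nullary using (¬_; Dec; yes; no)

open Function.Equivalence using (to; from)

-- Counting a list as two disjoint injective images.

length-disjoint-images :
  ∀ {A B C : Set} {g : A → C} {h : B → C} {xs ys zs} →
  (∀ {x y} → g x ≡ g y → x ≡ y) → (∀ {x y} → h x ≡ h y → x ≡ y) →
  Unique xs → Unique ys → Unique zs →
  (∀ {x} → x ∈ xs → g x ∈ zs) → (∀ {y} → y ∈ ys → h y ∈ zs) →
  (∀ {z} → z ∈ zs → (∃[ x ] x ∈ xs × z ≡ g x) ⊎ (∃[ y ] y ∈ ys × z ≡ h y)) →
  (∀ {x y} → x ∈ xs → y ∈ ys → ¬ g x ≡ h y) →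
  length zs ≡ length xs +ℕ length ys
length-disjoint-images {g = g} {h} {xs} {ys} {zs} g-inj h-inj xs! ys! zs! g∈ h∈ cover apart = begin
  -- Both lists are duplicate-free, so having the same members already makes them equal as bags,
  -- hence permutations of each other.
  length zs                              ≡⟨ ↭-length (∼bag⇒↭ (unique∧set⇒bag zs! images! (mk⇔ split join))) ⟩
  length (map g xs ++ map h ys)          ≡⟨ length-++ (map g xs) ⟩
  length (map g xs) +ℕ length (map h ys) ≡⟨ cong₂ _+ℕ_ (length-map g xs) (length-map h ys) ⟩
  length xs +ℕ length ys                 ∎
  where
  open ≡-Reasoning

  images! : Unique (map g xs ++ map h ys)
  images! = Unique.++⁺ (Unique.map⁺ g-inj xs!) (Unique.map⁺ h-inj ys!) disjoint
    where
    disjoint : ∀ {z} → ¬ (z ∈ map g xs × z ∈ map h ys)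
    disjoint (p , q) with ∈-map⁻ g p | ∈-map⁻ h q
    ... | _ , x∈ , refl | _ , y∈ , eq = apart x∈ y∈ eq

  split : ∀ {z} → z ∈ zs → z ∈ map g xs ++ map h ys
  split z∈ with cover z∈
  ... | inj₁ (_ , x∈ , refl) = ∈-++⁺ˡ (∈-map⁺ g x∈)
  ... | inj₂ (_ , y∈ , refl) = ∈-++⁺ʳ (map g xs) (∈-map⁺ h y∈)

  join : ∀ {z} → z ∈ map g xs ++ map h ys → z ∈ zs
  join z∈ with ∈-++⁻ (map g xs) z∈
  ... | inj₁ p with ∈-map⁻ g p
  ...   | _ , x∈ , refl = g∈ x∈
  join z∈ | inj₂ q with ∈-map⁻ h q
  ...   | _ , y∈ , refl = h∈ y∈

-- Reading parts at numeric positions, with `nothing` past the end.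

entry : ℕ → List ℕ → Maybe ℕ
entry i xs = head (drop i xs)

-- Positions are counted from 0: entry d is the part with number d + 1.
HasFixedPoint⇔entry : ∀ d xs → HasFixedPoint (suc d) xs ⇔ entry d xs ≡ just (suc d)
HasFixedPoint⇔entry d xs = mk⇔ (λ (i , i≡ , eq) → lookup⇒entry d xs i (suc-injective i≡) eq)
                               (λ eq → let i , i≡ , eq′ = entry⇒lookup d xs eq in i , cong suc i≡ , eq′)
  where
  lookup⇒entry : ∀ {v} i xs (j : Fin (length xs)) → toℕ j ≡ i → lookup xs j ≡ v → entry i xs ≡ just v
  lookup⇒entry _ (_ ∷ _)  zero    refl refl = refl
  lookup⇒entry _ (_ ∷ xs) (suc j) refl eq   = lookup⇒entry _ xs j refl eq

  entry⇒lookup : ∀ {v} i xs → entry i xs ≡ just v → ∃[ j ] toℕ {length xs} j ≡ i × lookup xs j ≡ v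
  entry⇒lookup zero    (_ ∷ _)  refl = zero , refl , refl
  entry⇒lookup (suc i) (_ ∷ xs) eq   with entry⇒lookup i xs eq
  ... | j , refl , eq′ = suc j , refl , eq′
  entry⇒lookup zero    []       ()
  entry⇒lookup (suc i) []       ()

entry-descends : ∀ i {xs v w} → Linked _≥_ xs → entry i xs ≡ just v → entry (suc i) xs ≡ just w → v ≥ w
entry-descends zero    (v≥w ∷ _) refl refl = v≥w
entry-descends (suc i) (_ ∷ l)   p    q    = entry-descends i l p q
entry-descends (suc i) []        ()   q
entry-descends (suc zero) [-]    ()   q
entry-descends (suc (suc i)) [-] ()   q

-- Supplies, from a fixed point at position `suc e`, the part at position `e` that the raising
-- lemmas ask for.
entry-pred : ∀ i xs {w} → entry (suc i) xs ≡ just w → ∃[ v ] entry i xs ≡ just v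
entry-pred zero    (v ∷ _)  _  = v , refl
entry-pred (suc i) (_ ∷ xs) eq = entry-pred i xs eq
entry-pred zero    []       ()
entry-pred (suc i) []       ()

-- Adding 1 to the first parts.

raise : ℕ → List ℕ → List ℕ
raise zero    xs       = xs
raise (suc k) []       = []
raise (suc k) (x ∷ xs) = suc x ∷ raise k xs

raise-injective : ∀ k {xs ys} → raise k xs ≡ raise k ys → xs ≡ ys
raise-injective zero    eq = eq
raise-injective (suc k) {[]}    {[]}    eq = refl
raise-injective (suc k) {_ ∷ _} {_ ∷ _} eq =
  cong₂ _∷_ (suc-injective (∷-injectiveˡ eq)) (raise-injective k (∷-injectiveʳ eq))

entry-raise-≥ : ∀ k xs → entry k (raise k xs) ≡ entry k xs
entry-raise-≥ zero    xs       = refl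
entry-raise-≥ (suc k) []       = refl
entry-raise-≥ (suc k) (x ∷ xs) = entry-raise-≥ k xs

entry-raise-< : ∀ i xs → entry i (raise (suc i) xs) ≡ Maybe.map suc (entry i xs)
entry-raise-< zero    []       = refl
entry-raise-< zero    (x ∷ xs) = refl
entry-raise-< (suc i) []       = refl
entry-raise-< (suc i) (x ∷ xs) = entry-raise-< i xs

-- Since `raise` stops silently at the end of a short list, the premise has to certify that all
-- `suc i` parts exist.
sum-raise : ∀ i xs {v} → entry i xs ≡ just v → sum (raise (suc i) xs) ≡ sum xs +ℕ suc i
sum-raise zero    (x ∷ xs) _  = +-comm 1 _
sum-raise (suc i) (x ∷ xs) eq rewrite sum-raise i xs eq =
  trans (cong suc (sym (+-assoc x (sum xs) (suc i)))) (sym (+-suc (x +ℕ sum xs) (suc i)))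
sum-raise zero    []       ()
sum-raise (suc i) []       ()

raise-positive : ∀ k {xs} → All NonZero xs → All NonZero (raise k xs)
raise-positive zero    ps       = ps
raise-positive (suc k) []       = []
raise-positive (suc k) (p ∷ ps) = _ ∷ raise-positive k ps

raise-nonincreasing : ∀ k {xs} → Linked _≥_ xs → Linked _≥_ (raise k xs)
raise-nonincreasing zero          l       = l
raise-nonincreasing (suc k)       []      = []
raise-nonincreasing (suc zero)    [-]     = [-]
raise-nonincreasing (suc (suc k)) [-]     = [-]
raise-nonincreasing (suc zero)    (p ∷ l) = m≤n⇒m≤1+n p ∷ l
raise-nonincreasing (suc (suc k)) (p ∷ l) = s≤s p ∷ raise-nonincreasing (suc k) l

-- Only the last lowered part can cause trouble. It becomes `v`, which is positive and, by the final
-- premise, not smaller than the part after it. Earlier parts are at least as large, so they stay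
-- positive and in order.
raise-surjective :
  ∀ i {xs v} → NonZero v → All NonZero xs → Linked _≥_ xs → entry i xs ≡ just (suc v) →
  (∀ {w} → entry (suc i) xs ≡ just w → v ≥ w) →
  ∃[ ys ] xs ≡ raise (suc i) ys × All NonZero ys × Linked _≥_ ys
raise-surjective zero {_ ∷ []}    v>0 _        _       refl _     = _ , refl , v>0 ∷ [] , [-]
raise-surjective zero {_ ∷ _ ∷ _} v>0 (_ ∷ ps) (_ ∷ l) refl below =
  _ , refl , v>0 ∷ ps , below refl ∷ l
raise-surjective (suc i) {_ ∷ _ ∷ _} v>0 (_ ∷ ps) (_ ∷ l) eq below
  with raise-surjective i v>0 ps l eq below
-- The lowered tail has a positive head, so the original tail starts with at least 2. The part in
-- front of it is no smaller and can be lowered as well.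
raise-surjective (suc i) {suc (suc _) ∷ _} v>0 _ (s≤s x≥y ∷ _) eq below
  | suc _ ∷ _ , refl , qs , l′ = _ , refl , _ ∷ qs , x≥y ∷ l′
raise-surjective (suc i) {suc zero ∷ _} v>0 _ (s≤s () ∷ _) eq below
  | suc _ ∷ _ , refl , qs , l′
raise-surjective (suc i) {_ ∷ _} v>0 _ (_ ∷ _) eq below
  | zero ∷ _ , refl , record { nonZero = () } ∷ _ , l′
raise-surjective (suc zero)    {_ ∷ []} _ _ _ () _
raise-surjective (suc (suc i)) {_ ∷ []} _ _ _ () _

-- Repeating one part.

duplicate : ℕ → List ℕ → List ℕ
duplicate i       []       = []
duplicate zero    (x ∷ xs) = x ∷ x ∷ xs
duplicate (suc i) (x ∷ xs) = x ∷ duplicate i xs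

duplicate-injective : ∀ i {xs ys} → duplicate i xs ≡ duplicate i ys → xs ≡ ys
duplicate-injective i       {[]}    {[]}    eq = refl
duplicate-injective zero    {_ ∷ _} {_ ∷ _} eq = ∷-injectiveʳ eq
duplicate-injective (suc i) {_ ∷ _} {_ ∷ _} eq =
  cong₂ _∷_ (∷-injectiveˡ eq) (duplicate-injective i (∷-injectiveʳ eq))
duplicate-injective zero    {[]}    {_ ∷ _} ()
duplicate-injective zero    {_ ∷ _} {[]}    ()
duplicate-injective (suc i) {[]}    {_ ∷ _} ()
duplicate-injective (suc i) {_ ∷ _} {[]}    ()

entry-duplicate : ∀ i xs → entry i (duplicate i xs) ≡ entry i xs
entry-duplicate zero    []       = refl
entry-duplicate (suc i) []       = refl
entry-duplicate zero    (x ∷ xs) = refl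
entry-duplicate (suc i) (x ∷ xs) = entry-duplicate i xs

entry-suc-duplicate : ∀ i xs → entry (suc i) (duplicate i xs) ≡ entry i xs
entry-suc-duplicate zero    []       = refl
entry-suc-duplicate (suc i) []       = refl
entry-suc-duplicate zero    (x ∷ xs) = refl
entry-suc-duplicate (suc i) (x ∷ xs) = entry-suc-duplicate i xs

sum-duplicate : ∀ i xs {v} → entry i xs ≡ just v → sum (duplicate i xs) ≡ sum xs +ℕ v
sum-duplicate zero    (x ∷ xs) refl = +-comm x _
sum-duplicate (suc i) (x ∷ xs) {v} eq rewrite sum-duplicate i xs eq = sym (+-assoc x (sum xs) v)
sum-duplicate zero    []       ()
sum-duplicate (suc i) []       ()

duplicate-positive : ∀ i {xs} → All NonZero xs → All NonZero (duplicate i xs)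
duplicate-positive i       []       = []
duplicate-positive zero    (p ∷ ps) = p ∷ p ∷ ps
duplicate-positive (suc i) (p ∷ ps) = p ∷ duplicate-positive i ps

duplicate-nonincreasing : ∀ i {xs} → Linked _≥_ xs → Linked _≥_ (duplicate i xs)
duplicate-nonincreasing i             []      = []
duplicate-nonincreasing zero          [-]     = ≤-refl ∷ [-]
duplicate-nonincreasing zero          (p ∷ l) = ≤-refl ∷ p ∷ l
duplicate-nonincreasing (suc i)       [-]     = [-]
duplicate-nonincreasing (suc zero)    (p ∷ l) = p ∷ duplicate-nonincreasing zero l
duplicate-nonincreasing (suc (suc i)) (p ∷ l) = p ∷ duplicate-nonincreasing (suc i) l

duplicate-surjective :
  ∀ i {xs v} → All NonZero xs → Linked _≥_ xs → entry i xs ≡ just v → entry (suc i) xs ≡ just v →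
  ∃[ ys ] xs ≡ duplicate i ys × All NonZero ys × Linked _≥_ ys
duplicate-surjective zero {_ ∷ _ ∷ _} (_ ∷ ps) (_ ∷ l) refl refl = _ , refl , ps , l
duplicate-surjective (suc i) {_ ∷ _ ∷ _} (p ∷ ps) (x≥y ∷ l) eq eq′
  with duplicate-surjective i ps l eq eq′
-- The next two clauses differ only in the index: `duplicate i (y ∷ ys)` exposes its head `y`, which
-- `x≥y` speaks of, only once `i` is a constructor form.
duplicate-surjective (suc zero)    (p ∷ ps) (x≥y ∷ l) eq eq′ | y ∷ ys , refl , qs , l′ =
  _ , refl , p ∷ qs , x≥y ∷ l′
duplicate-surjective (suc (suc i)) (p ∷ ps) (x≥y ∷ l) eq eq′ | y ∷ ys , refl , qs , l′ =
  _ , refl , p ∷ qs , x≥y ∷ l′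
duplicate-surjective (suc zero)    {_ ∷ []} _ _ () _
duplicate-surjective (suc (suc i)) {_ ∷ []} _ _ () _

-- Fixed-point partitions and flat partitions in terms of `entry`.

∈-fixedPointPartitions-suc : ∀ n k {xs} →
  xs ∈ fixedPointPartitions n (suc k) ⇔ (IsPartition n xs × entry k xs ≡ just (suc k))
∈-fixedPointPartitions-suc n k {xs} = mk⇔
  (λ p → let q , fp = to (∈-fixedPointPartitions n (suc k)) p
         in q , to (HasFixedPoint⇔entry k xs) fp)
  (λ (q , eq) → from (∈-fixedPointPartitions n (suc k)) (q , from (HasFixedPoint⇔entry k xs) eq))

-- Here `e` is d - 2, which builds d ≥ 2 into the indexing. Counted from 0, position `e` holds λ_k
-- and position `suc e` holds λ_d.
flat? : ∀ e xs → Dec (entry e xs ≡ just (2 +ℕ e))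
flat? e xs = ≡-dec _≟_ (entry e xs) (just (2 +ℕ e))

flatPartitions : ℕ → ℕ → List (List ℕ)
flatPartitions n e = filter (flat? e) (fixedPointPartitions n (2 +ℕ e))

flatPartitions-unique : ∀ n e → Unique (flatPartitions n e)
flatPartitions-unique n e = Unique.filter⁺ (flat? e) (fixedPointPartitions-unique n (2 +ℕ e))

∈-flatPartitions : ∀ n e {xs} →
  xs ∈ flatPartitions n e ⇔
  (IsPartition n xs × entry (suc e) xs ≡ just (2 +ℕ e) × entry e xs ≡ just (2 +ℕ e))
∈-flatPartitions n e = mk⇔
  (λ p → let q , flat = ∈-filter⁻ (flat? e) p
             part , fp = to (∈-fixedPointPartitions-suc n (suc e)) q
         in part , fp , flat)
  (λ (part , fp , flat) →
    ∈-filter⁺ (flat? e) (from (∈-fixedPointPartitions-suc n (suc e)) (part , fp)) flat)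

-- Raising and duplicating on partitions, and undoing both.

raise-partition : ∀ {n e xs v} → IsPartition n xs → entry e xs ≡ just v →
                  IsPartition (n +ℕ suc e) (raise (suc e) xs)
raise-partition {e = e} {xs} (isPartition pos noninc refl) eq =
  isPartition (raise-positive (suc e) pos) (raise-nonincreasing (suc e) noninc) (sum-raise e xs eq)

duplicate-partition : ∀ {n e xs v} → IsPartition n xs → entry e xs ≡ just v →
                      IsPartition (n +ℕ v) (duplicate e xs)
duplicate-partition {e = e} {xs} (isPartition pos noninc refl) eq =
  isPartition (duplicate-positive e pos) (duplicate-nonincreasing e noninc) (sum-duplicate e xs eq)

entry-raise-<⁻ : ∀ e ys {v} → entry e (raise (suc e) ys) ≡ just (suc v) → entry e ys ≡ just v
entry-raise-<⁻ e ys eq with entry e ys | trans (sym (entry-raise-< e ys)) eq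
... | just _ | refl = refl

unraise-partition : ∀ {n e xs v} → NonZero v → IsPartition (n +ℕ suc e) xs →
  entry e xs ≡ just (suc v) →
  (∀ {w} → entry (suc e) xs ≡ just w → v ≥ w) →
  ∃[ ys ] xs ≡ raise (suc e) ys × IsPartition n ys × entry e ys ≡ just v
unraise-partition {n} {e} v>0 (isPartition pos noninc sum≡) eq below
  with raise-surjective e v>0 pos noninc eq below
... | ys , refl , pos′ , noninc′ = ys , refl , isPartition pos′ noninc′ sum≡′ , eq′
  where
  eq′   = entry-raise-<⁻ e ys eq
  sum≡′ = +-cancelʳ-≡ (suc e) (sum ys) n (trans (sym (sum-raise e ys eq′)) sum≡)

unduplicate-partition : ∀ {n e xs v} → IsPartition (n +ℕ v) xs →
  entry e xs ≡ just v → entry (suc e) xs ≡ just v →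
  ∃[ ys ] xs ≡ duplicate e ys × IsPartition n ys × entry e ys ≡ just v
unduplicate-partition {n} {e} {v = v} (isPartition pos noninc sum≡) eq eq⁺
  with duplicate-surjective e pos noninc eq eq⁺
... | ys , refl , pos′ , noninc′ = ys , refl , isPartition pos′ noninc′ sum≡′ , eq′
  where
  eq′   = trans (sym (entry-duplicate e ys)) eq
  sum≡′ = +-cancelʳ-≡ v (sum ys) n (trans (sym (sum-duplicate e ys eq′)) sum≡)

-- The two counting identities and their combination.

f-raise : ∀ n e → f (n +ℕ suc e) (2 +ℕ e) ≡ f n (2 +ℕ e) +ℕ length (flatPartitions (n +ℕ suc e) e)
f-raise n e = length-disjoint-images
  (raise-injective (suc e)) id
  (fixedPointPartitions-unique n d) (flatPartitions-unique m e) (fixedPointPartitions-unique m d)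
  raise∈ (proj₁ ∘ ∈-filter⁻ (flat? e)) cover apart
  where
  d = 2 +ℕ e
  m = n +ℕ suc e

  raise∈ : ∀ {xs} → xs ∈ fixedPointPartitions n d → raise (suc e) xs ∈ fixedPointPartitions m d
  raise∈ {xs} xs∈ =
    let part , fp = to (∈-fixedPointPartitions-suc n (suc e)) xs∈
        _ , eq    = entry-pred e xs fp
    in from (∈-fixedPointPartitions-suc m (suc e))
            (raise-partition part eq , trans (entry-raise-≥ (suc e) xs) fp)

  cover : ∀ {zs} → zs ∈ fixedPointPartitions m d →
          (∃[ xs ] xs ∈ fixedPointPartitions n d × zs ≡ raise (suc e) xs) ⊎
          (∃[ ys ] ys ∈ flatPartitions m e × zs ≡ ys)
  cover {zs} zs∈ with flat? e zs
  ... | yes flat = inj₂ (zs , ∈-filter⁺ (flat? e) zs∈ flat , refl)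
  ... | no ¬flat with to (∈-fixedPointPartitions-suc m (suc e)) zs∈
  ...   | part , fp with entry-pred e zs fp
  -- Not being flat forces λ_k > d, so λ_k - 1 is still at least d = λ_d and lowering is allowed.
  -- The inner `s≤s` below shows that λ_k - 1 is a successor, which settles `NonZero`.
  ...     | v , eq with ≤∧≢⇒< (entry-descends e (IsPartition.nonincreasing part) eq fp)
                              (λ d≡v → ¬flat (trans eq (cong just (sym d≡v))))
  ...       | s≤s v≥d@(s≤s _) with unraise-partition _ part eq
                                (λ eq⁺ → subst (_ ≥_) (just-injective (trans (sym fp) eq⁺)) v≥d)
  ...         | xs , refl , part′ , eq′ =
    inj₁ (xs , from (∈-fixedPointPartitions-suc n (suc e))
                    (part′ , trans (sym (entry-raise-≥ (suc e) xs)) fp) , refl)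

  -- A raised partition that is flat would come from one with λ_k = d - 1 < d = λ_d.
  apart : ∀ {xs ys} → xs ∈ fixedPointPartitions n d → ys ∈ flatPartitions m e → ¬ raise (suc e) xs ≡ ys
  apart {xs} xs∈ ys∈ refl =
    let part , fp       = to (∈-fixedPointPartitions-suc n (suc e)) xs∈
        _ , _ , flat    = to (∈-flatPartitions m e) ys∈
    in <-irrefl refl (entry-descends e (IsPartition.nonincreasing part) (entry-raise-<⁻ e xs flat) fp)

-- In the notation of the overview, `n +ℕ suc e` is m and `n` is m - k, so no truncated subtraction
-- enters. The second map composes raising, which gives μ from its lowered form, with duplication.
flat-duplicate : ∀ n e → length (flatPartitions (n +ℕ suc e +ℕ (2 +ℕ e)) e) ≡
                         length (flatPartitions (n +ℕ suc e) e) +ℕ f n (suc e)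
flat-duplicate n e = length-disjoint-images
  (duplicate-injective e) (raise-injective (suc e) ∘ duplicate-injective e)
  (flatPartitions-unique m e) (fixedPointPartitions-unique n (suc e)) (flatPartitions-unique (m +ℕ d) e)
  (λ xs∈ → let part , _ , flat = to (∈-flatPartitions m e) xs∈ in duplicate∈ part flat)
  (λ {ys} ys∈ → let part , fp = to (∈-fixedPointPartitions-suc n e) ys∈
                in duplicate∈ (raise-partition part fp) (trans (entry-raise-< e ys) (cong (Maybe.map suc) fp)))
  cover apart
  where
  d = 2 +ℕ e
  m = n +ℕ suc e

  duplicate∈ : ∀ {xs} → IsPartition m xs → entry e xs ≡ just d → duplicate e xs ∈ flatPartitions (m +ℕ d) e
  duplicate∈ {xs} part eq = from (∈-flatPartitions (m +ℕ d) e)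
    (duplicate-partition part eq , trans (entry-suc-duplicate e xs) eq , trans (entry-duplicate e xs) eq)

  cover : ∀ {zs} → zs ∈ flatPartitions (m +ℕ d) e →
          (∃[ xs ] xs ∈ flatPartitions m e × zs ≡ duplicate e xs) ⊎
          (∃[ ys ] ys ∈ fixedPointPartitions n (suc e) × zs ≡ duplicate e (raise (suc e) ys))
  cover zs∈ with to (∈-flatPartitions (m +ℕ d) e) zs∈
  ... | part , fp , flat with unduplicate-partition part flat fp
  ...   | xs , refl , part′ , eq with ≡-dec _≟_ (entry (suc e) xs) (just d)
  ...     | yes fp′ = inj₁ (xs , from (∈-flatPartitions m e) (part′ , fp′ , eq) , refl)
  ...     | no ¬fp′ with unraise-partition _ part′ eq below
    where
    -- As μ_k = d and μ_d is not d, a part μ_d is at most d - 1, the value of μ_k after lowering. If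
    -- μ has only k parts, the premise never holds.
    below : ∀ {w} → entry (suc e) xs ≡ just w → suc e ≥ w
    below eq⁺ = s≤s⁻¹ (≤∧≢⇒< (entry-descends e (IsPartition.nonincreasing part′) eq eq⁺)
                             (λ { refl → ¬fp′ eq⁺ }))
  ...       | ys , refl , part″ , eq″ =
    inj₂ (ys , from (∈-fixedPointPartitions-suc n e) (part″ , eq″) , refl)

  -- Cancelling `duplicate e` leaves a raised `ys` with d at position `suc e`. Raising does not
  -- touch that position, so `ys` would increase from d - 1 to d.
  apart : ∀ {xs ys} → xs ∈ flatPartitions m e → ys ∈ fixedPointPartitions n (suc e) →
          ¬ duplicate e xs ≡ duplicate e (raise (suc e) ys)
  apart {_} {ys} xs∈ ys∈ eq with refl ← duplicate-injective e eq =
    let _ , fp , _  = to (∈-flatPartitions m e) xs∈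
        part , fp′  = to (∈-fixedPointPartitions-suc n e) ys∈
    in <-irrefl refl (entry-descends e (IsPartition.nonincreasing part) fp′
                                     (trans (sym (entry-raise-≥ (suc e) ys)) fp))

-- The flat count at `m +ℕ d` is reached by `f-raise` from `n +ℕ d` and by `flat-duplicate` from
-- `m`. Having `f n d` on the left lets `f-raise` from `n` absorb the remaining flat count at `m`
-- without subtraction.
f-recurrence : ∀ n e →
  f (n +ℕ suc e +ℕ (2 +ℕ e)) (2 +ℕ e) +ℕ f n (2 +ℕ e) ≡
  f (n +ℕ (2 +ℕ e)) (2 +ℕ e) +ℕ f (n +ℕ suc e) (2 +ℕ e) +ℕ f n (suc e)
f-recurrence n e = begin
  f (m +ℕ d) d +ℕ f n d                          ≡⟨ cong (λ l → f l d +ℕ f n d) m+d≡ ⟩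
  f (n +ℕ d +ℕ suc e) d +ℕ f n d                 ≡⟨ cong (_+ℕ f n d) (f-raise (n +ℕ d) e) ⟩
  f (n +ℕ d) d +ℕ b (n +ℕ d +ℕ suc e) +ℕ f n d   ≡⟨ cong (λ l → f (n +ℕ d) d +ℕ b l +ℕ f n d) m+d≡ ⟨
  f (n +ℕ d) d +ℕ b (m +ℕ d) +ℕ f n d            ≡⟨ cong (λ l → f (n +ℕ d) d +ℕ l +ℕ f n d) (flat-duplicate n e) ⟩
  f (n +ℕ d) d +ℕ (b m +ℕ f n (suc e)) +ℕ f n d  ≡⟨ shuffle (f (n +ℕ d) d) (b m) (f n (suc e)) (f n d) ⟩
  f (n +ℕ d) d +ℕ (f n d +ℕ b m) +ℕ f n (suc e)  ≡⟨ cong (λ l → f (n +ℕ d) d +ℕ l +ℕ f n (suc e)) (f-raise n e) ⟨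
  f (n +ℕ d) d +ℕ f m d +ℕ f n (suc e)           ∎
  where
  open ≡-Reasoning
  d = 2 +ℕ e
  m = n +ℕ suc e

  b : ℕ → ℕ
  b l = length (flatPartitions l e)

  m+d≡ : m +ℕ d ≡ n +ℕ d +ℕ suc e
  m+d≡ = trans (+-assoc n (suc e) d) (trans (cong (n +ℕ_) (+-comm (suc e) d)) (sym (+-assoc n d (suc e))))

  shuffle : ∀ w x y z → w +ℕ (x +ℕ y) +ℕ z ≡ w +ℕ (z +ℕ x) +ℕ y
  shuffle = ℕ-Solver.solve-∀

-- Passage to truncated subtraction and to the integers.

2*d≤d^2 : ∀ {d} → d ≥ 2 → 2 * d ≤ d ^ 2
2*d≤d^2 {d} d≥2 = *-mono-≤ d≥2 (≤-reflexive (sym (*-identityʳ d)))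

theorem1p1 : ∀ (n d : ℕ) → d ≥ 2 → n ≥ d ^ 2 →
    + f n d ≡ + f (n ∸ d +ℕ 1) d + + f (n ∸ d) d - + f (n ∸ 2 * d +ℕ 1) d
    + + f (n ∸ 2 * d +ℕ 1) (d ∸ 1)
theorem1p1 n (suc zero) (s≤s ())
theorem1p1 n d@(suc (suc e)) d≥2 n≥d^2 = begin
  -- A sum of two `+_` terms reduces to `+_` of the natural sum, so the recurrence over ℕ applies
  -- once `f k d` is added and subtracted.
  + f n d                           ≡⟨ isolate (+ f n d) (+ f k d) ⟩
  + (f n d +ℕ f k d) - + f k d      ≡⟨ cong (λ l → + l - + f k d) recurrence ⟩
  + (f (n ∸ d +ℕ 1) d +ℕ f (n ∸ d) d +ℕ f k (suc e)) - + f k d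
    ≡⟨ swap (+ f (n ∸ d +ℕ 1) d) (+ f (n ∸ d) d) (+ f k (suc e)) (+ f k d) ⟩
  + f (n ∸ d +ℕ 1) d + + f (n ∸ d) d - + f k d + + f k (suc e) ∎
  where
  open ≡-Reasoning
  -- Not the k = d - 1 of the overview, but the smallest argument of `f`, where `f-recurrence` is
  -- applied. As n ≥ d^2 ≥ 2d, no subtraction is cut off at 0.
  k = n ∸ 2 * d +ℕ 1

  isolate : ∀ x y → x ≡ x + y - y
  isolate = ℤ-Solver.solve-∀

  swap : ∀ w x y z → w + x + y - z ≡ w + x - z + y
  swap = ℤ-Solver.solve-∀

  k+e≡n∸d : k +ℕ suc e ≡ n ∸ d
  k+e≡n∸d = begin
    n ∸ 2 * d +ℕ 1 +ℕ suc e ≡⟨ +-assoc (n ∸ 2 * d) 1 (suc e) ⟩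
    -- The term `1 +ℕ suc e` reduces to `d`. Adding and removing another `d` makes 2d ≤ n
    -- applicable.
    n ∸ 2 * d +ℕ d          ≡⟨ m+n∸n≡m (n ∸ 2 * d +ℕ d) d ⟨
    n ∸ 2 * d +ℕ d +ℕ d ∸ d ≡⟨ cong (_∸ d) (double (n ∸ 2 * d) d) ⟩
    n ∸ 2 * d +ℕ 2 * d ∸ d  ≡⟨ cong (_∸ d) (m∸n+n≡m 2d≤n) ⟩
    n ∸ d                   ∎
    where
    2d≤n = ≤-trans (2*d≤d^2 d≥2) n≥d^2
    double : ∀ x y → x +ℕ y +ℕ y ≡ x +ℕ 2 * y
    double = ℕ-Solver.solve-∀

  k+d≡n∸d+1 : k +ℕ d ≡ n ∸ d +ℕ 1
  k+d≡n∸d+1 = trans (+-suc k (suc e)) (trans (cong suc k+e≡n∸d) (+-comm 1 (n ∸ d)))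

  d≤n : d ≤ n
  d≤n = ≤-trans (m≤m+n d _) (≤-trans (2*d≤d^2 d≥2) n≥d^2)

  k+e+d≡n : k +ℕ suc e +ℕ d ≡ n
  k+e+d≡n = trans (cong (_+ℕ d) k+e≡n∸d) (m∸n+n≡m d≤n)

  recurrence : f n d +ℕ f k d ≡ f (n ∸ d +ℕ 1) d +ℕ f (n ∸ d) d +ℕ f k (suc e)
  recurrence = begin
    f n d +ℕ f k d                                   ≡⟨ cong (λ l → f l d +ℕ f k d) k+e+d≡n ⟨
    f (k +ℕ suc e +ℕ d) d +ℕ f k d                   ≡⟨ f-recurrence k e ⟩
    f (k +ℕ d) d +ℕ f (k +ℕ suc e) d +ℕ f k (suc e)
      ≡⟨ cong₂ (λ x y → f x d +ℕ f y d +ℕ f k (suc e)) k+d≡n∸d+1 k+e≡n∸d ⟩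
    f (n ∸ d +ℕ 1) d +ℕ f (n ∸ d) d +ℕ f k (suc e)   ∎
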